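{- Let $r\ge1$ and $d\ge1$ be integers. There is a bijection between partitions of $\mathbb N$ into $r$ non-empty sets, each $d$-scattered, and partitions of $\mathbb N$ into $r+1$ non-empty sets, each $(d+1)$-scattered.
   Context: A subset $A\subseteq\mathbb N$ is $d$-scattered if for all $p<q$ in $A$ we have $q-p\ge d$. -}

module Defs where

open import Level using (0ℓ; suc)
open import Data.Fin.Base using (Fin)
open import Data.Nat.Base using (ℕ; _<_; _≤_; _∸_)
open import Data.Product.Base using (_×_; _,_; ∃-syntax; Σ-syntax; proj₁; proj₂)
open import Relation.Binary.Bundles using (Setoid)
open import Relation.Binary.Structures using (IsEquivalence)
open import Relation.Binary.PropositionalEquality.Core using (_≢_)
import Relation.Binary.Construct.On as On
open import Relation.Unary using (Pred; _∈_; _≐_; _⊥_; Satisfiable)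
open import Relation.Unary.Properties using (≐-refl; ≐-trans)

-- Truncated subtraction is ordinary subtraction here, since p < q.
Scattered : ℕ → Pred ℕ 0ℓ → Set
Scattered d A = ∀ {p q} → p ∈ A → q ∈ A → p < q → d ≤ q ∸ p

-- The indexing of the blocks by Fin r expresses that there are exactly r
-- of them (non-empty disjoint blocks are distinct); it is forgotten by _≋_.
record Partition (r : ℕ) : Set (suc 0ℓ) where
  field
    block    : Fin r → Pred ℕ 0ℓ
    nonEmpty : ∀ i → Satisfiable (block i)
    disjoint : ∀ {i j} → i ≢ j → block i ⊥ block j
    covers   : ∀ n → ∃[ i ] n ∈ block i

open Partition public

_⊑_ : ∀ {r} → Partition r → Partition r → Set
P ⊑ Q = ∀ i → ∃[ j ] block P i ≐ block Q j

-- Equality of partitions as unordered sets of blocks.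
_≋_ : ∀ {r} → Partition r → Partition r → Set
P ≋ Q = (P ⊑ Q) × (Q ⊑ P)

⊑-refl : ∀ {r} (P : Partition r) → P ⊑ P
⊑-refl P i = i , ≐-refl

⊑-trans : ∀ {r} (P Q R : Partition r) → P ⊑ Q → Q ⊑ R → P ⊑ R
⊑-trans P Q R P⊑Q Q⊑R i with P⊑Q i
... | j , Pi≐Qj with Q⊑R j
...   | k , Qj≐Rk = k , ≐-trans Pi≐Qj Qj≐Rk

≋-isEquivalence : ∀ {r} → IsEquivalence (_≋_ {r})
≋-isEquivalence = record
  { refl  = λ {P} → ⊑-refl P , ⊑-refl P
  ; sym   = λ (P⊑Q , Q⊑P) → Q⊑P , P⊑Q
  ; trans = λ {P} {Q} {R} (P⊑Q , Q⊑P) (Q⊑R , R⊑Q) →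
              ⊑-trans P Q R P⊑Q Q⊑R , ⊑-trans R Q P R⊑Q Q⊑P
  }

partitionSetoid : ℕ → Setoid (suc 0ℓ) 0ℓ
partitionSetoid r = record
  { Carrier       = Partition r
  ; _≈_           = _≋_
  ; isEquivalence = ≋-isEquivalence
  }

ScatteredPartition : ℕ → ℕ → Set (suc 0ℓ)
ScatteredPartition r d = Σ[ P ∈ Partition r ] (∀ i → Scattered d (block P i))

scatteredPartitionSetoid : ℕ → ℕ → Setoid (suc 0ℓ) 0ℓ
scatteredPartitionSetoid r d =
  On.setoid (partitionSetoid r) (proj₁ {B = λ P → ∀ i → Scattered d (block P i)})

{-# OPTIONS --safe #-}

-- A partition of ℕ is determined by the function sending each element to its
-- predecessor in its block, if any.  The functions arising in this way are the
-- injective decreasing partial functions; the blocks are counted by the points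
-- without predecessor, and the blocks are d-scattered iff every predecessor is
-- at distance at least d.  Replacing each arc (i , j) by (i , j + 1) lengthens
-- all arcs by one and makes 0 the only additional point without predecessor;
-- as arcs of length at least 2 can be shortened, this is reversible.
module Submission where

open import Defs
open import Level using (0ℓ)
open import Data.Empty using (⊥-elim)
open import Data.Fin.Base as Fin using (Fin; punchIn; punchOut)
open import Data.Fin.Properties as Fin
  using (punchIn-injective; punchIn-punchOut; punchInᵢ≢i)
open import Data.Maybe.Base using (Maybe; just; nothing)
open import Data.Nat.Base using (ℕ; zero; suc; pred; _≤_; _<_; _+_; _∸_; s≤s; z≤n; s≤s⁻¹)
open import Data.Nat.Induction using (<-rec)
open import Data.Nat.Properties
open import Data.Product.Base using (_×_; _,_; ∃-syntax; proj₁; proj₂)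
open import Data.Sum.Base using (_⊎_; inj₁; inj₂)
open import Function.Base using (_∘_)
open import Function.Bundles using (Bijection; Inverse)
import Function.Construct.Composition as Composition
import Function.Construct.Symmetry as Symmetry
open import Function.Properties.Inverse using (Inverse⇒Bijection)
open import Relation.Binary.Bundles using (Setoid)
open import Relation.Binary.Definitions using (tri<; tri≈; tri>)
import Relation.Binary.Construct.On as On
open import Relation.Binary.PropositionalEquality
  using (_≡_; _≢_; _≗_; _→-setoid_; refl; sym; trans; cong; subst)
open import Relation.Nullary using (¬_; yes; no)
open import Relation.Nullary.Decidable using (decidable-stable)
open import Relation.Unary using (Pred; Decidable; _∈_; _⊆_; _≐_)
open import Relation.Unary.Properties using (≐-sym)

-- The last element of a decidable set below a bound.

data LastBelow (P : Pred ℕ 0ℓ) (n : ℕ) : Maybe ℕ → Set where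
  last : ∀ {i} → i < n → P i → (∀ {k} → i < k → k < n → ¬ P k) →
         LastBelow P n (just i)
  none : (∀ {k} → k < n → ¬ P k) → LastBelow P n nothing

lastBelow : ∀ {P} → Decidable P → ∀ n → ∃[ m ] LastBelow P n m
lastBelow P? zero = nothing , none λ ()
lastBelow {P} P? (suc n) with P? n
... | yes Pn = just n , last ≤-refl Pn λ n<k k<1+n _ → <⇒≱ n<k (s≤s⁻¹ k<1+n)
... | no ¬Pn with lastBelow P? n
...   | just i , last i<n Pi max = just i , last (m<n⇒m<1+n i<n) Pi max′
  where
  max′ : ∀ {k} → i < k → k < suc n → ¬ P k
  max′ i<k k<1+n Pk with m≤n⇒m<n∨m≡n (s≤s⁻¹ k<1+n)
  ... | inj₁ k<n  = max i<k k<n Pk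
  ... | inj₂ refl = ¬Pn Pk
...   | nothing , none empty = nothing , none empty′
  where
  empty′ : ∀ {k} → k < suc n → ¬ P k
  empty′ k<1+n Pk with m≤n⇒m<n∨m≡n (s≤s⁻¹ k<1+n)
  ... | inj₁ k<n  = empty k<n Pk
  ... | inj₂ refl = ¬Pn Pk

-- Allowing two predicates lets this compare predecessors in two equal partitions as well.
LastBelow-unique : ∀ {P Q n m m′} → P ≐ Q → LastBelow P n m → LastBelow Q n m′ → m ≡ m′
LastBelow-unique (P⊆Q , Q⊆P) (last {i} i<n Pi max) (last {j} j<n Qj max′) with <-cmp i j
... | tri< i<j _ _  = ⊥-elim (max i<j j<n (Q⊆P Qj))
... | tri≈ _ refl _ = refl
... | tri> _ _ j<i  = ⊥-elim (max′ j<i i<n (P⊆Q Pi))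
LastBelow-unique (P⊆Q , _) (last i<n Pi _) (none empty) = ⊥-elim (empty i<n (P⊆Q Pi))
LastBelow-unique (_ , Q⊆P) (none empty) (last j<n Qj _) = ⊥-elim (empty j<n (Q⊆P Qj))
LastBelow-unique _ (none _) (none _) = refl

-- Chains of arcs and their lowest points.

data Path (left : ℕ → Maybe ℕ) (a : ℕ) : ℕ → Set where
  stop : Path left a a
  step : ∀ {i j} → left j ≡ just i → Path left a i → Path left a j

Path-resp-≗ : ∀ {f g a} → f ≗ g → Path f a ⊆ Path g a
Path-resp-≗ f≗g stop               = stop
Path-resp-≗ f≗g (step {j = j} e p) = step (trans (sym (f≗g j)) e) (Path-resp-≗ f≗g p)

module Decreasing (left : ℕ → Maybe ℕ) (decreasing : ∀ {i j} → left j ≡ just i → i < j) where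

  root : ∀ n → ∃[ o ] left o ≡ nothing × Path left o n
  root = <-rec HasRoot λ n rec → go n rec (left n) refl
    where
    HasRoot : ℕ → Set
    HasRoot n = ∃[ o ] left o ≡ nothing × Path left o n

    go : ∀ n → (∀ {m} → m < n → HasRoot m) → ∀ m → left n ≡ m → HasRoot n
    go n rec nothing  e = n , e , stop
    go n rec (just i) e with rec (decreasing e)
    ... | o , eₒ , p = o , eₒ , step e p

  Path⇒≤ : ∀ {a b} → Path left a b → a ≤ b
  Path⇒≤ stop       = ≤-refl
  Path⇒≤ (step e p) = ≤-trans (Path⇒≤ p) (<⇒≤ (decreasing e))

  -- Going down from `n` there is only one way to continue, since `left` is a function, and a point
  -- without `left` ends the descent.
  Path-source-unique : ∀ {n o o′} → left o ≡ nothing → Path left o n →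
                       left o′ ≡ nothing → Path left o′ n → o ≡ o′
  Path-source-unique _ stop _ stop = refl
  Path-source-unique e stop _ (step e′ _) with () ← trans (sym e) e′
  Path-source-unique _ (step e _) e′ stop with () ← trans (sym e) e′
  Path-source-unique eₒ (step e p) eₒ′ (step e′ p′) with refl ← trans (sym e) e′ =
    Path-source-unique eₒ p eₒ′ p′

  module _ (injective : ∀ {i j k} → left i ≡ just k → left j ≡ just k → i ≡ j) where

    -- Paths are built at their upper end; this exposes the lowest arc.
    Path-uncons : ∀ {a b} → Path left a b → a ≡ b ⊎ (∃[ c ] left c ≡ just a × Path left c b)
    Path-uncons stop = inj₁ refl
    Path-uncons (step e p) with Path-uncons p
    ... | inj₁ refl         = inj₂ (_ , e , stop)
    ... | inj₂ (c , e′ , q) = inj₂ (c , e′ , step e q)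

    -- By injectivity at most one arc goes up from each point, so chains with a common lower end do
    -- not branch: if the second path ends with an arc from `i` to `j` and `i` lies strictly below
    -- `a`, the first arc from `i` towards `a` is that same arc.
    Path-total : ∀ {o a b} → Path left o a → Path left o b → Path left a b ⊎ Path left b a
    Path-total p stop = inj₂ p
    Path-total p (step e q) with Path-total p q
    ... | inj₁ a⇝i = inj₁ (step e a⇝i)
    ... | inj₂ i⇝a with Path-uncons i⇝a
    ...   | inj₁ refl = inj₁ (step e stop)
    ...   | inj₂ (c , e′ , c⇝a) with refl ← injective e e′ = inj₂ c⇝a

    -- Both points lie on one chain, and `a < b` puts `a` lower, so the arc into `b` starts at `a`
    -- or above. Scatteredness and the recovery of `left` from its partition rest on this.
    left-between : ∀ {o a b} → Path left o a → Path left o b → a < b →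
                   ∃[ i ] left b ≡ just i × a ≤ i
    left-between p q a<b with Path-total p q
    ... | inj₁ stop         = ⊥-elim (<-irrefl refl a<b)
    ... | inj₁ (step e a⇝i) = _ , e , Path⇒≤ a⇝i
    ... | inj₂ b⇝a          = ⊥-elim (<⇒≱ a<b (Path⇒≤ b⇝a))

-- Arc diagrams.

record Arcs (r d : ℕ) : Set where
  field
    left              : ℕ → Maybe ℕ
    long              : ∀ {i j} → left j ≡ just i → i + d ≤ j
    injective         : ∀ {i j k} → left i ≡ just k → left j ≡ just k → i ≡ j
    -- The points without `left` are enumerated once each by `Fin r`, which fixes the number of
    -- blocks.
    opener            : Fin r → ℕ
    left-opener       : ∀ k → left (opener k) ≡ nothing
    opener-injective  : ∀ {k l} → opener k ≡ opener l → k ≡ l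
    opener-surjective : ∀ {j} → left j ≡ nothing → ∃[ k ] opener k ≡ j

open Arcs

-- Only `left` is compared: the order of the openers is forgotten, just as `_≋_` forgets the
-- numbering of blocks.
arcsSetoid : ℕ → ℕ → Setoid 0ℓ 0ℓ
arcsSetoid r d = On.setoid (ℕ →-setoid Maybe ℕ) (left {r} {d})

-- From partitions to arcs.

module _ {r : ℕ} (P : Partition r) where

  -- Blocks are arbitrary predicates, but equality of labels is decidable, so the previous element
  -- of a block can be found by search.
  label : ℕ → Fin r
  label n = proj₁ (covers P n)

  ∈-label : ∀ n → n ∈ block P (label n)
  ∈-label n = proj₂ (covers P n)

  ∈⇒label : ∀ {n k} → n ∈ block P k → label n ≡ k
  ∈⇒label {n} {k} n∈k =
    decidable-stable (label n Fin.≟ k) λ neq → disjoint P neq (∈-label n , n∈k)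

  label⇒∈ : ∀ {n k} → label n ≡ k → n ∈ block P k
  label⇒∈ refl = ∈-label _

  predecessor-spec : ∀ n → ∃[ m ] LastBelow (λ i → label i ≡ label n) n m
  predecessor-spec n = lastBelow (λ i → label i Fin.≟ label n) n

  predecessor : ℕ → Maybe ℕ
  predecessor n = proj₁ (predecessor-spec n)

  predecessor-just : ∀ {i j} → predecessor j ≡ just i →
    i < j × label i ≡ label j × (∀ {k} → i < k → k < j → label k ≢ label j)
  predecessor-just {j = j} e with predecessor-spec j
  predecessor-just refl | just i , last i<j eq max = i<j , eq , λ {k} → max {k}

  predecessor-nothing : ∀ {i j} → predecessor j ≡ nothing → i < j → label i ≢ label j
  predecessor-nothing {j = j} e with predecessor-spec j
  predecessor-nothing refl | nothing , none empty = empty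

  open Decreasing predecessor (λ e → proj₁ (predecessor-just e)) using (root)

  -- If `k` preceded two points, the smaller would be an element of the block strictly between `k`
  -- and the larger.
  predecessor-injective : ∀ {i j k} → predecessor i ≡ just k → predecessor j ≡ just k → i ≡ j
  predecessor-injective {i} {j} e e′
    with predecessor-just e | predecessor-just e′ | <-cmp i j
  ... | _ | _ | tri≈ _ i≡j _ = i≡j
  ... | k<i , eq , _ | _ , eq′ , max | tri< i<j _ _ = ⊥-elim (max k<i i<j (trans (sym eq) eq′))
  ... | _ , eq , max | k<j , eq′ , _ | tri> _ _ j<i = ⊥-elim (max k<j j<i (trans (sym eq′) eq))

  label-path : ∀ {a b} → Path predecessor a b → label a ≡ label b
  label-path stop       = refl
  label-path (step e p) = trans (label-path p) (proj₁ (proj₂ (predecessor-just e)))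

  -- `nonEmpty` supplies an arbitrary element; descending from it by predecessors reaches the least
  -- one.
  minimum : Fin r → ℕ
  minimum k = proj₁ (root (proj₁ (nonEmpty P k)))

  predecessor-minimum : ∀ k → predecessor (minimum k) ≡ nothing
  predecessor-minimum k = proj₁ (proj₂ (root (proj₁ (nonEmpty P k))))

  label-minimum : ∀ k → label (minimum k) ≡ k
  label-minimum k =
    trans (label-path (proj₂ (proj₂ (root (proj₁ (nonEmpty P k)))))) (∈⇒label (proj₂ (nonEmpty P k)))

  minimum-unique : ∀ {i j} → predecessor i ≡ nothing → predecessor j ≡ nothing →
                   label i ≡ label j → i ≡ j
  minimum-unique {i} {j} e e′ eq with <-cmp i j
  ... | tri< i<j _ _ = ⊥-elim (predecessor-nothing e′ i<j eq)
  ... | tri≈ _ i≡j _ = i≡j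
  ... | tri> _ _ j<i = ⊥-elim (predecessor-nothing e j<i (sym eq))

  minimum-label : ∀ {j} → predecessor j ≡ nothing → minimum (label j) ≡ j
  minimum-label e = minimum-unique (predecessor-minimum _) e (label-minimum _)

  toArcs : ∀ {d} → (∀ k → Scattered d (block P k)) → Arcs r d
  toArcs {d} scattered = record
    { left              = predecessor
    ; long              = distant
    ; injective         = predecessor-injective
    ; opener            = minimum
    ; left-opener       = predecessor-minimum
    ; opener-injective  = λ {k} {l} eq →
        trans (sym (label-minimum k)) (trans (cong label eq) (label-minimum l))
    ; opener-surjective = λ e → _ , minimum-label e
    }
    where
    distant : ∀ {i j} → predecessor j ≡ just i → i + d ≤ j
    distant {i} {j} e with predecessor-just e
    ... | i<j , eq , _ = subst (i + d ≤_) (m+[n∸m]≡n (<⇒≤ i<j))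
      (+-monoʳ-≤ i (scattered (label j) (label⇒∈ eq) (∈-label j) i<j))

  -- Descending from any element of the block ends at a point without predecessor and with the same
  -- label, which can only be the minimum. Hence the arcs of a partition determine its blocks.
  block≐path : ∀ k → block P k ≐ Path predecessor (minimum k)
  block≐path k = block⊆path , λ p → label⇒∈ (trans (sym (label-path p)) (label-minimum k))
    where
    block⊆path : block P k ⊆ Path predecessor (minimum k)
    block⊆path {n} n∈k with root n
    ... | o , e , p = subst (λ a → Path predecessor a n) (sym minimum≡o) p
      where
      minimum≡o : minimum k ≡ o
      minimum≡o = minimum-unique (predecessor-minimum k) e
        (trans (label-minimum k) (sym (trans (label-path p) (∈⇒label n∈k))))

⊑⇒label : ∀ {r} {P Q : Partition r} → P ⊑ Q →
          ∀ {i j} → label P i ≡ label P j → label Q i ≡ label Q j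
⊑⇒label {P = P} {Q} P⊑Q {i} {j} eq with P⊑Q (label P j)
... | _ , P⊆Q , _ =
  trans (∈⇒label Q (P⊆Q (label⇒∈ P eq))) (sym (∈⇒label Q (P⊆Q (∈-label P j))))

-- Equal partitions may number their blocks differently, but the relation of having equal labels is
-- the same, and predecessors depend on nothing else.
predecessor-cong : ∀ {r} {P Q : Partition r} → P ≋ Q → predecessor P ≗ predecessor Q
predecessor-cong {P = P} {Q} (P⊑Q , Q⊑P) n = LastBelow-unique
  (⊑⇒label {P = P} {Q} P⊑Q , ⊑⇒label {P = Q} {P} Q⊑P)
  (proj₂ (predecessor-spec P n)) (proj₂ (predecessor-spec Q n))

-- From arcs to partitions.

module _ {r d : ℕ} (1≤d : 1 ≤ d) (A : Arcs r d) where

  -- The bound `1 ≤ d` excludes arcs of length zero, so descending along arcs terminates.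
  decreasing : ∀ {i j} → left A j ≡ just i → i < j
  decreasing {i} e = ≤-trans (m<m+n i 1≤d) (long A e)

  open Decreasing (left A) decreasing

  toPartition : Partition r
  toPartition = record
    { block    = λ k → Path (left A) (opener A k)
    ; nonEmpty = λ k → opener A k , stop
    ; disjoint = λ k≢l (p , q) → k≢l (opener-injective A
        (Path-source-unique (left-opener A _) p (left-opener A _) q))
    ; covers   = covering
    }
    where
    covering : ∀ n → ∃[ k ] Path (left A) (opener A k) n
    covering n with root n
    ... | o , e , p with opener-surjective A e
    ...   | k , refl = k , p

  toPartition-scattered : ∀ k → Scattered d (block toPartition k)
  toPartition-scattered k {a} {b} p q a<b with left-between (injective A) p q a<b
  -- The arc into `b` starts at some `i ≥ a`, whence `a + d ≤ i + d ≤ b`.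
  ... | i , e , a≤i = subst (_≤ b ∸ a) (m+n∸m≡n a d)
    (∸-monoˡ-≤ a (≤-trans (+-monoˡ-≤ d a≤i) (long A e)))

  sameLabel⇒between : ∀ {i j} → label toPartition i ≡ label toPartition j → i < j →
                      ∃[ m ] left A j ≡ just m × i ≤ m
  sameLabel⇒between eq = left-between (injective A)
    (label⇒∈ toPartition eq) (∈-label toPartition _)

  -- By `left-between`, an element below `n` in its block forces an arc into `n` and cannot exceed
  -- the start of that arc.
  left-lastBelow : ∀ n → LastBelow (λ i → label toPartition i ≡ label toPartition n) n (left A n)
  left-lastBelow n = go (left A n) refl
    where
    go : ∀ m → left A n ≡ m → LastBelow (λ i → label toPartition i ≡ label toPartition n) n m
    go nothing e = none λ k<n eq → case-nothing (sameLabel⇒between eq k<n)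
      where
      case-nothing : ∀ {k} → ¬ (∃[ m ] left A n ≡ just m × k ≤ m)
      case-nothing (_ , e′ , _) with () ← trans (sym e) e′
    go (just i) e = last (decreasing e)
      (sym (∈⇒label toPartition (step e (∈-label toPartition i)))) maximal
      where
      maximal : ∀ {k} → i < k → k < n → label toPartition k ≢ label toPartition n
      maximal i<k k<n eq with sameLabel⇒between eq k<n
      ... | m , e′ , k≤m with refl ← trans (sym e) e′ = <⇒≱ i<k k≤m

  predecessor-toPartition : predecessor toPartition ≗ left A
  predecessor-toPartition n = LastBelow-unique ((λ eq → eq) , (λ eq → eq))
    (proj₂ (predecessor-spec toPartition n)) (left-lastBelow n)

toPartition-⊑ : ∀ {r d} (1≤d : 1 ≤ d) (A B : Arcs r d) → left A ≗ left B →
                toPartition 1≤d A ⊑ toPartition 1≤d B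
toPartition-⊑ 1≤d A B A≗B k
  -- An opener of `A` has no `left` in `B` either, so it is an opener of `B`, possibly under another
  -- index.
  with opener-surjective B (trans (sym (A≗B (opener A k))) (left-opener A k))
... | l , eq = l , subst (λ a → Path (left A) (opener A k) ≐ Path (left B) a) (sym eq)
  (Path-resp-≗ A≗B , Path-resp-≗ (sym ∘ A≗B))

-- The points in the congruence hypotheses are explicit because unification
-- cannot recover them from the equalities of the setoids used here.
module _ {a ℓ₁ b ℓ₂} (S : Setoid a ℓ₁) (T : Setoid b ℓ₂) where

  private
    module S = Setoid S
    module T = Setoid T

  strictInverse : (to : S.Carrier → T.Carrier) (from : T.Carrier → S.Carrier) →
                  (∀ x y → x S.≈ y → to x T.≈ to y) →
                  (∀ x y → x T.≈ y → from x S.≈ from y) →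
                  (∀ y → to (from y) T.≈ y) → (∀ x → from (to x) S.≈ x) → Inverse S T
  strictInverse to from to-cong from-cong to-from from-to = record
    { to        = to
    ; from      = from
    ; to-cong   = λ {x} {y} → to-cong x y
    ; from-cong = λ {x} {y} → from-cong x y
    ; inverse   =
        (λ {y} {x} x≈ → T.trans {to x} {to (from y)} {y} (to-cong x (from y) x≈) (to-from y))
      , (λ {x} {y} y≈ → S.trans {from y} {from (to x)} {x} (from-cong y (to x) y≈) (from-to x))
    }

-- The correspondence between partitions and arcs.

partition↔arcs : ∀ r {d} → 1 ≤ d → Inverse (scatteredPartitionSetoid r d) (arcsSetoid r d)
partition↔arcs r {d} 1≤d = strictInverse (scatteredPartitionSetoid r d) (arcsSetoid r d)
  (λ (P , scattered) → toArcs P scattered)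
  (λ A → toPartition 1≤d A , toPartition-scattered 1≤d A)
  (λ (P , _) (Q , _) → predecessor-cong {P = P} {Q})
  (λ A B A≗B → toPartition-⊑ 1≤d A B A≗B , toPartition-⊑ 1≤d B A (sym ∘ A≗B))
  (predecessor-toPartition 1≤d)
  (λ (P , _) → (λ k → k , ≐-sym (block≐path P k)) , (λ k → k , block≐path P k))

-- Lengthening and shortening all arcs by one.

lengthen : ∀ {r d} → Arcs r d → Arcs (suc r) (suc d)
lengthen {r} {d} A = record
  { left              = left′
  ; long              = long′
  ; injective         = injective′
  ; opener            = opener′
  ; left-opener       = left-opener′
  ; opener-injective  = opener-injective′
  ; opener-surjective = opener-surjective′
  }
  where
  left′ : ℕ → Maybe ℕ
  left′ zero    = nothing
  left′ (suc n) = left A n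

  long′ : ∀ {i j} → left′ j ≡ just i → i + suc d ≤ j
  long′ {i} {suc j} e = subst (_≤ suc j) (sym (+-suc i d)) (s≤s (long A e))

  injective′ : ∀ {i j k} → left′ i ≡ just k → left′ j ≡ just k → i ≡ j
  injective′ {suc _} {suc _} e e′ = cong suc (injective A e e′)

  opener′ : Fin (suc r) → ℕ
  opener′ Fin.zero    = zero
  opener′ (Fin.suc k) = suc (opener A k)

  left-opener′ : ∀ k → left′ (opener′ k) ≡ nothing
  left-opener′ Fin.zero    = refl
  left-opener′ (Fin.suc k) = left-opener A k

  opener-injective′ : ∀ {k l} → opener′ k ≡ opener′ l → k ≡ l
  opener-injective′ {Fin.zero}  {Fin.zero}  _  = refl
  opener-injective′ {Fin.suc _} {Fin.suc _} eq = cong Fin.suc (opener-injective A (suc-injective eq))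

  opener-surjective′ : ∀ {j} → left′ j ≡ nothing → ∃[ k ] opener′ k ≡ j
  opener-surjective′ {zero}  _ = Fin.zero , refl
  opener-surjective′ {suc j} e with opener-surjective A e
  ... | k , eq = Fin.suc k , cong suc eq

-- There is no room below `0` for an arc of positive length.
left-zero : ∀ {r d} (A : Arcs r (suc d)) → left A 0 ≡ nothing
left-zero {d = d} A with left A 0 in e
... | nothing = refl
... | just i with () ← subst (_≤ 0) (+-suc i d) (long A e)

shorten : ∀ {r d} → Arcs (suc r) (suc d) → Arcs r d
shorten {r} {d} A = record
  { left              = left A ∘ suc
  ; long              = λ {i} {j} e → s≤s⁻¹ (subst (_≤ suc j) (+-suc i d) (long A e))
  ; injective         = λ e e′ → suc-injective (injective A e e′)
  ; opener            = opener′
  ; left-opener       = λ k → trans (cong (left A) (suc-opener′ k)) (left-opener A (punchIn k₀ k))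
  ; opener-injective  = λ {k} {l} eq → punchIn-injective k₀ k l (opener-injective A
      (trans (sym (suc-opener′ k)) (trans (cong suc eq) (suc-opener′ l))))
  ; opener-surjective = opener-surjective′
  }
  where
  -- The opener `0` may have any index, so this index is cut out by `punchIn` and the others are
  -- renumbered.
  k₀ : Fin (suc r)
  k₀ = proj₁ (opener-surjective A (left-zero A))

  opener-k₀ : opener A k₀ ≡ 0
  opener-k₀ = proj₂ (opener-surjective A (left-zero A))

  opener′ : Fin r → ℕ
  opener′ k = pred (opener A (punchIn k₀ k))

  suc-opener′ : ∀ k → suc (opener′ k) ≡ opener A (punchIn k₀ k)
  suc-opener′ k with opener A (punchIn k₀ k) in eq
  ... | suc _ = refl
  -- Another opener at `0` would have index `k₀`, which `punchIn k₀` avoids; hence `pred` acts on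
  -- positive openers only.
  ... | zero  = ⊥-elim (punchInᵢ≢i k₀ k (opener-injective A (trans eq (sym opener-k₀))))

  opener-surjective′ : ∀ {j} → left A (suc j) ≡ nothing → ∃[ k ] opener′ k ≡ j
  opener-surjective′ {j} e with opener-surjective A e
  ... | k , eq = punchOut k₀≢k , cong pred (trans (cong (opener A) (punchIn-punchOut k₀≢k)) eq)
    where
    k₀≢k : k₀ ≢ k
    k₀≢k refl with () ← trans (sym opener-k₀) eq

arcs↔arcs : ∀ r d → Inverse (arcsSetoid r d) (arcsSetoid (suc r) (suc d))
arcs↔arcs r d = strictInverse (arcsSetoid r d) (arcsSetoid (suc r) (suc d)) lengthen shorten
  (λ { _ _ _ zero → refl ; _ _ A≗B (suc n) → A≗B n })
  (λ _ _ A≗B → A≗B ∘ suc)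
  -- `shorten` discards the value at `0`, and `lengthen` puts back `nothing`, the only value
  -- possible there.
  (λ { A zero → sym (left-zero A) ; _ (suc _) → refl })
  (λ _ _ → refl)

theorem4p1 : (r d : ℕ) → 1 ≤ r → 1 ≤ d →
    Bijection (scatteredPartitionSetoid r d) (scatteredPartitionSetoid (r + 1) (d + 1))
-- The sums become `suc r` and `suc d`, the form in which `lengthen` adds an opener and a unit of
-- length.
theorem4p1 r d _ 1≤d rewrite +-comm r 1 | +-comm d 1 = Inverse⇒Bijection
  (Composition.inverse (partition↔arcs r 1≤d)
    (Composition.inverse (arcs↔arcs r d)
      (Symmetry.inverse (partition↔arcs (suc r) (s≤s z≤n)))))
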